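{- Let $\mathbf{L}\in\{\mathbf{K}_D,\mathbf{KD}_D\}$. Let $\Gamma,\Delta$ be finite multisets of formulas, $p$ a propositional variable and $a$ an agent symbol. Then there exists a formula $A$ such that: (i) $\mathsf{V}(A)\subseteq\mathsf{V}(\Gamma\cup\Delta)\setminus\{p\}$ and $\mathsf{Agt}(A)\subseteq\mathsf{Agt}(\Gamma\cup\Delta)\setminus\{a\}$; (ii) $\mathsf{G}(\mathbf{L})\vdash\Gamma,A\Rightarrow\Delta$; (iii) for all finite multisets $\Pi,\Lambda$ of formulas with $p\notin\mathsf{V}(\Pi\cup\Lambda)$ and $a\notin\mathsf{Agt}(\Pi\cup\Lambda)$: if $\mathsf{G}(\mathbf{L})\vdash\Pi,\Gamma\Rightarrow\Delta,\Lambda$, then $\mathsf{G}(\mathbf{L})\vdash\Pi\Rightarrow A,\Lambda$.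
   Context: Language: fix a finite nonempty set $\mathsf{Agt}$ of agent symbols and a countable set $\mathsf{Prop}$ of propositional variables; $\mathsf{Grp}$ is the set of nonempty subsets of $\mathsf{Agt}$. Formulas: $\alpha::=p\mid\bot\mid\alpha\wedge\alpha\mid\alpha\vee\alpha\mid\alpha\rightarrow\alpha\mid\neg\alpha\mid D_G\alpha$ with $p\in\mathsf{Prop}$, $G\in\mathsf{Grp}$. $\mathsf{V}(\cdot)$ is the set of propositional variables occurring, $\mathsf{Agt}(\cdot)$ the set of agent symbols occurring (the union of all $G$ with $D_G$ occurring); for multisets these are unions. An outmost-boxed formula is one of the form $D_G\gamma$. Sequent calculi: a sequent $\Gamma\Rightarrow\Delta$ is a pair of finite multisets of formulas; $\mathsf{G}(\mathbf{L})\vdash S$ means $S$ is the root of a finite tree built from initial sequents by the rules. $\mathsf{G}(\mathbf{K}_D)$ has initial sequents $\Gamma,p\Rightarrow p,\Delta$ ($p\in\mathsf{Prop}$) and $\bot,\Gamma\Rightarrow\Delta$; the propositional rules: $(R\wedge)$ from $\Gamma\Rightarrow\Delta,\alpha_1$ and $\Gamma\Rightarrow\Delta,\alpha_2$ infer $\Gamma\Rightarrow\Delta,\alpha_1\wedge\alpha_2$; $(L\wedge)$ from $\alpha_1,\alpha_2,\Gamma\Rightarrow\Delta$ infer $\alpha_1\wedge\alpha_2,\Gamma\Rightarrow\Delta$; $(R\vee)$ from $\Gamma\Rightarrow\Delta,\alpha_1,\alpha_2$ infer $\Gamma\Rightarrow\Delta,\alpha_1\vee\alpha_2$; $(L\vee)$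 from $\alpha_1,\Gamma\Rightarrow\Delta$ and $\alpha_2,\Gamma\Rightarrow\Delta$ infer $\alpha_1\vee\alpha_2,\Gamma\Rightarrow\Delta$; $(R\rightarrow)$ from $\alpha_1,\Gamma\Rightarrow\Delta,\alpha_2$ infer $\Gamma\Rightarrow\Delta,\alpha_1\rightarrow\alpha_2$; $(L\rightarrow)$ from $\Gamma\Rightarrow\Delta,\alpha_1$ and $\alpha_2,\Gamma\Rightarrow\Delta$ infer $\alpha_1\rightarrow\alpha_2,\Gamma\Rightarrow\Delta$; $(R\neg)$ from $\alpha,\Gamma\Rightarrow\Delta$ infer $\Gamma\Rightarrow\Delta,\neg\alpha$; $(L\neg)$ from $\Gamma\Rightarrow\Delta,\alpha$ infer $\neg\alpha,\Gamma\Rightarrow\Delta$; and $(D_K)$: from $\alpha_1,\dots,\alpha_n\Rightarrow\beta$ ($n\ge0$) infer $\Sigma,D_{G_1}\alpha_1,\dots,D_{G_n}\alpha_n\Rightarrow D_G\beta,\Omega$, provided $G_i\subseteq G$ for all $i$, $\Sigma$ consists only of propositional variables, $\bot$, and formulas $D_H\gamma$ with $H\not\subseteq G$, and $\Omega$ consists only of propositional variables, $\bot$ and outmost-boxed formulas. $\mathsf{G}(\mathbf{KD}_D)$ adds $(D_D)$: from $\Gamma\Rightarrow$ (empty succedent) with $\Gamma$ nonempty infer $\Sigma,D_{\{a\}}\Gamma\Rightarrow\Omega$ ($a\in\mathsf{Agt}$, $D_{\{a\}}\Gamma=\{D_{\{a\}}\gamma:\gamma\in\Gamma\}$), provided $\Sigma$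 consists only of propositional variables, $\bot$, and formulas $D_H\gamma$ with $H\neq\{a\}$, and $\Omega$ only of propositional variables, $\bot$ and outmost-boxed formulas. -}

module Defs where

open import Data.Fin using (Fin)
open import Data.Fin.Subset using (Subset; Nonempty; ⁅_⁆) renaming (_∈_ to _∈ˢ_; _⊆_ to _⊆ˢ_; _⊈_ to _⊈ˢ_)
open import Data.Fin.Subset.Properties using (x∈⁅x⁆)
open import Data.Irrelevant using ([_])
open import Data.List using (List; []; _∷_; _++_; map)
open import Data.List.Relation.Binary.Permutation.Propositional using (_↭_)
open import Data.List.Relation.Unary.All using (All)
open import Data.List.Relation.Unary.Any using (Any)
open import Data.Nat using (ℕ)
open import Data.Product using (_×_; proj₁; proj₂; uncurry)
open import Data.Refinement using (Refinement-syntax; value; _,_)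
open import Level using (0ℓ)
open import Relation.Binary.PropositionalEquality using (_≢_)
open import Relation.Unary using (Pred; _∈_; _∪_; ∅; ｛_｝; U)

-- The agents are Fin n.  Nonemptiness is stored irrelevantly, so that groups
-- (and hence formulas) with the same members are equal.
Grp : ℕ → Set
Grp n = [ G ∈ Subset n ∣ Nonempty G ]

singleton : ∀ {n} → Fin n → Grp n
singleton a = ⁅ a ⁆ , [ a Data.Product., x∈⁅x⁆ a ]

infixr 7 _∧ᶠ_
infixr 6 _∨ᶠ_
infixr 5 _→ᶠ_
infix  8 ¬ᶠ_

data Formula (n : ℕ) (Atom : Set) : Set where
  var  : Atom → Formula n Atom
  ⊥ᶠ   : Formula n Atom
  _∧ᶠ_ : Formula n Atom → Formula n Atom → Formula n Atom
  _∨ᶠ_ : Formula n Atom → Formula n Atom → Formula n Atom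
  _→ᶠ_ : Formula n Atom → Formula n Atom → Formula n Atom
  ¬ᶠ_  : Formula n Atom → Formula n Atom
  D    : Grp n → Formula n Atom → Formula n Atom

module _ {n : ℕ} {Atom : Set} where

  V : Formula n Atom → Pred Atom 0ℓ
  V (var q)  = ｛ q ｝
  V ⊥ᶠ       = ∅
  V (α ∧ᶠ β) = V α ∪ V β
  V (α ∨ᶠ β) = V α ∪ V β
  V (α →ᶠ β) = V α ∪ V β
  V (¬ᶠ α)   = V α
  V (D G α)  = V α

  Agt : Formula n Atom → Pred (Fin n) 0ℓ
  Agt (var q)  = ∅
  Agt ⊥ᶠ       = ∅
  Agt (α ∧ᶠ β) = Agt α ∪ Agt β
  Agt (α ∨ᶠ β) = Agt α ∪ Agt β
  Agt (α →ᶠ β) = Agt α ∪ Agt β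
  Agt (¬ᶠ α)   = Agt α
  Agt (D G α)  = (_∈ˢ value G) ∪ Agt α

  V* : List (Formula n Atom) → Pred Atom 0ℓ
  V* Γ q = Any (λ α → q ∈ V α) Γ

  Agt* : List (Formula n Atom) → Pred (Fin n) 0ℓ
  Agt* Γ b = Any (λ α → b ∈ Agt α) Γ

  -- The formulas allowed in the contexts Σ, Ω of the modal rules: variables,
  -- ⊥, and boxed formulas D H γ whose group satisfies P.
  data Passive (P : Pred (Grp n) 0ℓ) : Pred (Formula n Atom) 0ℓ where
    var : ∀ {q} → Passive P (var q)
    bot : Passive P ⊥ᶠ
    box : ∀ {H γ} → P H → Passive P (D H γ)

data Logic : Set where
  K-D KD-D : Logic

infix 3 _⊢_⇒_

-- L ⊢ Γ ⇒ Δ is derivability in G(L).  Finite multisets are lists up to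
-- permutation: perm identifies lists presenting the same multiset.
data _⊢_⇒_ {n : ℕ} {Atom : Set} : Logic → List (Formula n Atom) → List (Formula n Atom) → Set where

  perm : ∀ {L Γ Γ′ Δ Δ′} → Γ ↭ Γ′ → Δ ↭ Δ′ → L ⊢ Γ ⇒ Δ → L ⊢ Γ′ ⇒ Δ′

  init : ∀ {L Γ Δ q} → L ⊢ var q ∷ Γ ⇒ var q ∷ Δ
  L⊥   : ∀ {L Γ Δ} → L ⊢ ⊥ᶠ ∷ Γ ⇒ Δ

  R∧ : ∀ {L Γ Δ α β} → L ⊢ Γ ⇒ α ∷ Δ → L ⊢ Γ ⇒ β ∷ Δ → L ⊢ Γ ⇒ α ∧ᶠ β ∷ Δ
  L∧ : ∀ {L Γ Δ α β} → L ⊢ α ∷ β ∷ Γ ⇒ Δ → L ⊢ α ∧ᶠ β ∷ Γ ⇒ Δ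
  R∨ : ∀ {L Γ Δ α β} → L ⊢ Γ ⇒ α ∷ β ∷ Δ → L ⊢ Γ ⇒ α ∨ᶠ β ∷ Δ
  L∨ : ∀ {L Γ Δ α β} → L ⊢ α ∷ Γ ⇒ Δ → L ⊢ β ∷ Γ ⇒ Δ → L ⊢ α ∨ᶠ β ∷ Γ ⇒ Δ
  R→ : ∀ {L Γ Δ α β} → L ⊢ α ∷ Γ ⇒ β ∷ Δ → L ⊢ Γ ⇒ (α →ᶠ β) ∷ Δ
  L→ : ∀ {L Γ Δ α β} → L ⊢ Γ ⇒ α ∷ Δ → L ⊢ β ∷ Γ ⇒ Δ → L ⊢ (α →ᶠ β) ∷ Γ ⇒ Δ
  R¬ : ∀ {L Γ Δ α} → L ⊢ α ∷ Γ ⇒ Δ → L ⊢ Γ ⇒ ¬ᶠ α ∷ Δ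
  L¬ : ∀ {L Γ Δ α} → L ⊢ Γ ⇒ α ∷ Δ → L ⊢ ¬ᶠ α ∷ Γ ⇒ Δ

  -- Θ lists the pairs (Gᵢ , αᵢ).
  D-K : ∀ {L Σ Ω G β} (Θ : List (Grp n × Formula n Atom)) →
        All (λ θ → value (proj₁ θ) ⊆ˢ value G) Θ →
        All (Passive (λ H → value H ⊈ˢ value G)) Σ →
        All (Passive U) Ω →
        L ⊢ map proj₂ Θ ⇒ β ∷ [] →
        L ⊢ Σ ++ map (uncurry D) Θ ⇒ D G β ∷ Ω

  D-D : ∀ {Σ Ω} (a : Fin n) (Γ : List (Formula n Atom)) → Γ ≢ [] →
        All (Passive (λ H → value H ≢ ⁅ a ⁆)) Σ →
        All (Passive U) Ω →
        KD-D ⊢ Γ ⇒ [] →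
        KD-D ⊢ Σ ++ map (D (singleton a)) Γ ⇒ Ω

{-# OPTIONS --safe #-}
-- The calculus is sound and complete for finite labelled trees, so provability
-- may be replaced by truth in trees.  By recursion on the weight of the
-- sequent, A is built so that it is false at a tree T exactly when some tree
-- T′, agreeing with T on all formulas without p and a, refutes Γ ⇒ Δ; this is
-- Pitts' characterisation of A as ∀p∀a(⋀Γ → ⋁Δ).
--
-- Propositional connectives are removed by the invertible rules.  For an
-- unprovable sequent of variables, ⊥ and boxed formulas, A is the disjunction
-- of its literals other than p, of D_{G∖a} A(Γ_G ⇒ β) for D_G β ∈ Δ, and of
-- ¬ D_K ¬ A(Γ_K ⇒ ) for unions K ∌ a of groups occurring in Γ, where
-- Γ_G = {α : D_H α ∈ Γ, H ⊆ G}.  If A is false at T, then T′ is amalgamated from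
-- modified copies of the successors of T, witnesses for the boxed formulas of
-- Δ, and successors reachable by a alone, which are taken from a countermodel
-- of the sequent.
module Submission where

open import Defs
open import Data.Bool using (Bool; true; false; if_then_else_)
open import Data.Bool.Properties using () renaming (_≟_ to _≟ᵇ_)
open import Data.Empty using (⊥; ⊥-elim)
open import Data.Fin using (Fin; suc) renaming (_≟_ to _≟ᶠ_)
open import Data.Fin.Subset using (Subset; Nonempty; ⁅_⁆; ⊤; _-_) renaming (_∈_ to _∈ˢ_; _∉_ to _∉ˢ_; _⊆_ to _⊆ˢ_; _⊈_ to _⊈ˢ_; _∪_ to _∪ˢ_; ⊥ to ⊥ˢ)
open import Data.Fin.Subset.Properties using (_⊆?_; _∈?_; nonempty?; ∈⊤; ∉⊥; x∈⁅x⁆; x∈⁅y⁆⇒x≡y; ⊆-antisym; x∈p∪q⁻; x∈p∪q⁺; p─q⊆p; x∈p∧x≢y⇒x∈p-y)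
open import Data.Irrelevant using ([_])
open import Data.List using (List; []; _∷_; _++_; map; filter; length; allFin)
open import Data.List.Membership.Propositional using (_∈_; find; lose) renaming (_∉_ to _∉ˡ_)
open import Data.List.Membership.Propositional.Properties using (∈-++⁺ˡ; ∈-++⁺ʳ; ∈-++⁻; ∈-map⁺; ∈-map⁻; ∈-filter⁺; ∈-filter⁻; ∈-allFin; ∈-∃++)
open import Data.List.Properties using (map-++)
open import Data.List.Relation.Binary.Permutation.Propositional using (_↭_; ↭-refl; ↭-sym; ↭-trans; ↭-reflexive; prep; swap)
open import Data.List.Relation.Binary.Permutation.Propositional.Properties using (All-resp-↭; shift; ++⁺ˡ) renaming (map⁺ to ↭-map⁺)
open import Data.List.Relation.Unary.All as All using (All; []; _∷_; all?)
open import Data.List.Relation.Unary.All.Properties using (++⁺; ++⁻ˡ; ++⁻ʳ; all-filter) renaming (map⁺ to All-map⁺)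
open import Data.List.Relation.Unary.Any using (Any; here; there; any?)
open import Data.Nat using (ℕ; suc; _+_; _≤_; _<_; z≤n; s≤s; NonZero)
open import Data.Nat.Induction using (<-wellFounded)
open import Data.Nat.ListAction using (sum)
open import Data.Nat.ListAction.Properties using (sum-↭; sum-++)
open import Data.Nat.Properties using (≤-trans; ≤-reflexive; m≤m+n; m≤n+m; m≤n⇒m≤1+n; +-identityʳ; +-monoˡ-<; +-monoʳ-≤; +-mono-≤; +-mono-≤-<; +-mono-<-≤; eq?; module ≤-Reasoning)
open import Data.Nat.Tactic.RingSolver using (solve-∀)
open import Data.Product using (_×_; _,_; proj₁; proj₂; uncurry; ∃-syntax)
open import Data.Refinement using (value; value-injective) renaming (_,_ to _⸴_)
open import Data.Sum as Sum using (_⊎_; inj₁; inj₂; [_,_]′)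
import Data.Vec as Vec
open import Function.Base using (_∘_; id)
open import Function.Bundles using (_↣_)
open import Induction.WellFounded using (Acc; acc)
open import Level using (Level; 0ℓ)
open import Relation.Binary.Definitions using (DecidableEquality)
open import Relation.Binary.PropositionalEquality using (_≡_; _≢_; refl; sym; trans; cong; cong₂; subst)
open import Relation.Nullary using (¬_; Dec; yes; no; contradiction; recompute; does)
open import Relation.Nullary.Decidable using (map′; _×-dec_; _⊎-dec_; _→-dec_; ¬?; decidable-stable; dec-true)
open import Relation.Unary using (Pred; U; _⊆_; _∉_; _∖_; ｛_｝)

-- Finite choice and subsets of agents.

nonempty : ∀ {n} (G : Grp n) → Nonempty (value G)
nonempty (G ⸴ [ ne ]) = recompute (nonempty? G) ne

∈⇒↭ : ∀ {A : Set} {x : A} {xs} → x ∈ xs → ∃[ ys ] xs ↭ x ∷ ys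
∈⇒↭ {x = x} x∈ with ∈-∃++ x∈
... | ys , zs , refl = ys ++ zs , shift x ys zs

sequence : ∀ {A I : Set} {B : I → Set} {is} → All (λ i → A ⊎ B i) is → A ⊎ All B is
sequence []             = inj₂ []
sequence (inj₁ a ∷ _)   = inj₁ a
sequence (inj₂ b ∷ abs) with sequence abs
... | inj₁ a  = inj₁ a
... | inj₂ bs = inj₂ (b ∷ bs)

-- Finite choice. The last component keeps foreign elements out of the list, so that a property of
-- every chosen child of a node can be read off from `R`.
choose : ∀ {A B : Set} {R : A → B → Set} {xs} → All (λ x → ∃[ y ] R x y) xs →
         ∃[ ys ] All (λ x → ∃[ y ] y ∈ ys × R x y) xs × All (λ y → ∃[ x ] x ∈ xs × R x y) ys
choose [] = [] , [] , []
choose ((y , r) ∷ rs) with choose rs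
... | ys , f , b = y ∷ ys , (y , here refl , r) ∷ All.map (λ (z , z∈ , r′) → z , there z∈ , r′) f
                          , (_ , here refl , r) ∷ All.map (λ (z , z∈ , r′) → z , there z∈ , r′) b

does⇒ : ∀ {A : Set} (a? : Dec A) → does a? ≡ true → A
does⇒ (yes a) _ = a

∉-remove : ∀ {n} (G : Subset n) a → a ∉ˢ G - a
∉-remove (_ Vec.∷ G) (suc a) (Vec.there a∈) = ∉-remove G a a∈

⊆-remove : ∀ {n} {G H : Subset n} {a} → H ⊆ˢ G → a ∉ˢ H → H ⊆ˢ G - a
⊆-remove H⊆ a∉ x∈ = x∈p∧x≢y⇒x∈p-y (H⊆ x∈) (λ { refl → a∉ x∈ })

-- Labelled trees, forcing and soundness.

module _ {n : ℕ} {Atom : Set} where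

  private
    F : Set
    F = Formula n Atom

  -- Used with the vocabulary of the sequent as a bound on interpolants, and with `p ≢_` and `a ≢_`
  -- for the formulas that mention neither `p` nor `a`.
  Over : Pred Atom 0ℓ → Pred (Fin n) 0ℓ → F → Set
  Over P Q α = (∀ {q} → V α q → P q) × (∀ {b} → Agt α b → Q b)

  -- Edges carry arbitrary subsets of agents; an edge labelled G′ is an
  -- accessibility step for every group G ⊆ G′.  The tree loop is a reflexive
  -- point, which makes serial models available without infinite trees.
  data Tree : Set where
    loop : Tree
    node : (Atom → Bool) → List (Subset n × Tree) → Tree

  val : Tree → Atom → Bool
  val loop       q = false
  val (node v _) q = v q

  succs : Tree → List (Subset n × Tree)
  succs loop        = (⊤ , loop) ∷ []
  succs (node _ cs) = cs

  -- Seriality is asked of single agents, matching the singleton group of `D-D`; an edge for `b` may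
  -- carry any label containing `b`.
  data Good (L : Logic) : Tree → Set where
    loop : Good L loop
    node : ∀ {v cs} → (L ≡ KD-D → ∀ b → ∃[ c ] c ∈ cs × b ∈ˢ proj₁ c) →
           All (λ c → Good L (proj₂ c)) cs → Good L (node v cs)

  serial : ∀ {T} → Good KD-D T → ∀ b → ∃[ c ] c ∈ succs T × b ∈ˢ proj₁ c
  serial loop       b = _ , here refl , ∈⊤
  serial (node s _) b = s refl b

  good-succs : ∀ {L T c} → Good L T → c ∈ succs T → Good L (proj₂ c)
  good-succs loop       (here refl) = loop
  good-succs (node _ g) c∈          = All.lookup g c∈

  infix 4 _⊩_ _⊩?_

  _⊩_ : Tree → F → Set
  T ⊩ var q    = val T q ≡ true
  T ⊩ ⊥ᶠ       = ⊥
  T ⊩ (α ∧ᶠ β) = T ⊩ α × T ⊩ β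
  T ⊩ (α ∨ᶠ β) = T ⊩ α ⊎ T ⊩ β
  T ⊩ (α →ᶠ β) = T ⊩ α → T ⊩ β
  T ⊩ (¬ᶠ α)   = ¬ (T ⊩ α)
  T ⊩ D G α    = ∀ {c} → c ∈ succs T → value G ⊆ˢ proj₁ c → proj₂ c ⊩ α

  _⊩?_ : ∀ T α → Dec (T ⊩ α)
  T ⊩? var q    = val T q ≟ᵇ true
  T ⊩? ⊥ᶠ       = no id
  T ⊩? (α ∧ᶠ β) = (T ⊩? α) ×-dec (T ⊩? β)
  T ⊩? (α ∨ᶠ β) = (T ⊩? α) ⊎-dec (T ⊩? β)
  T ⊩? (α →ᶠ β) = (T ⊩? α) →-dec (T ⊩? β)
  T ⊩? (¬ᶠ α)   = ¬? (T ⊩? α)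
  T ⊩? D G α    = map′ (λ all c∈ → All.lookup all c∈) (λ f → All.tabulate (λ c∈ → f c∈))
    (all? (λ c → (value G ⊆? proj₁ c) →-dec (proj₂ c ⊩? α)) (succs T))

  -- Successor lists are finite, so forcing is decidable; this supplies the classical steps for
  -- implication, negation and boxes.
  stable : ∀ {T} α → ¬ ¬ (T ⊩ α) → T ⊩ α
  stable {T} α = decidable-stable (T ⊩? α)

  Refutes : Tree → List F → List F → Set
  Refutes T Γ Δ = All (T ⊩_) Γ × All (λ δ → ¬ (T ⊩ δ)) Δ

  refutes-++⁺ : ∀ {T} {X Y Γ Δ : List F} → Refutes T X Y → Refutes T Γ Δ → Refutes T (X ++ Γ) (Y ++ Δ)
  refutes-++⁺ (x , y) (γ , δ) = ++⁺ x γ , ++⁺ y δ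

  refutes-++⁻ : ∀ {T} (X Y : List F) {Γ Δ} → Refutes T (X ++ Γ) (Y ++ Δ) → Refutes T X Y × Refutes T Γ Δ
  refutes-++⁻ X Y (xγ , yδ) = (++⁻ˡ X xγ , ++⁻ˡ Y yδ) , (++⁻ʳ X xγ , ++⁻ʳ Y yδ)

  refutes-↭ : ∀ {T} {Γ Γ′ Δ Δ′ : List F} → Γ ↭ Γ′ → Δ ↭ Δ′ → Refutes T Γ Δ → Refutes T Γ′ Δ′
  refutes-↭ π ρ (γ , δ) = All-resp-↭ π γ , All-resp-↭ ρ δ

  force-unboxed : ∀ {T c} {G : Subset n} (Θ : List (Grp n × F)) → All (λ θ → value (proj₁ θ) ⊆ˢ G) Θ →
                  All (T ⊩_) (map (uncurry D) Θ) → c ∈ succs T → G ⊆ˢ proj₁ c → All (proj₂ c ⊩_) (map proj₂ Θ)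
  force-unboxed []      _         _         c∈ G⊆ = []
  force-unboxed (_ ∷ Θ) (H⊆ ∷ H⊆s) (f ∷ fs) c∈ G⊆ = f c∈ (G⊆ ∘ H⊆) ∷ force-unboxed Θ H⊆s fs c∈ G⊆

  soundness : ∀ {L T} {Γ Δ : List F} → L ⊢ Γ ⇒ Δ → Good L T → ¬ Refutes T Γ Δ
  soundness (perm π ρ d) g r = soundness d g (refutes-↭ (↭-sym π) (↭-sym ρ) r)
  soundness init g (q ∷ _ , ¬q ∷ _) = ¬q q
  soundness L⊥ g (() ∷ _ , _)
  soundness (R∧ d e) g (γ , ¬αβ ∷ δ) = soundness d g (γ , (λ α → soundness e g (γ , (λ β → ¬αβ (α , β)) ∷ δ)) ∷ δ)
  soundness (L∧ d) g ((α , β) ∷ γ , δ) = soundness d g (α ∷ β ∷ γ , δ)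
  soundness (R∨ d) g (γ , ¬αβ ∷ δ) = soundness d g (γ , ¬αβ ∘ inj₁ ∷ ¬αβ ∘ inj₂ ∷ δ)
  soundness (L∨ d e) g (inj₁ α ∷ γ , δ) = soundness d g (α ∷ γ , δ)
  soundness (L∨ d e) g (inj₂ β ∷ γ , δ) = soundness e g (β ∷ γ , δ)
  soundness (R→ {β = β} d) g (γ , ¬αβ ∷ δ) =
    ¬αβ (λ α → stable β (λ ¬β → soundness d g (α ∷ γ , ¬β ∷ δ)))
  soundness (L→ d e) g (αβ ∷ γ , δ) = soundness d g (γ , (λ α → soundness e g (αβ α ∷ γ , δ)) ∷ δ)
  soundness (R¬ d) g (γ , ¬¬α ∷ δ) = ¬¬α (λ α → soundness d g (α ∷ γ , δ))
  soundness (L¬ d) g (¬α ∷ γ , δ) = soundness d g (γ , ¬α ∷ δ)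
  soundness (D-K {Σ = Σ} {β = β} Θ Θ⊆ _ _ d) g (γ , ¬box ∷ _) = ¬box λ c∈ G⊆ → stable β λ ¬β →
    soundness d (good-succs g c∈) (force-unboxed Θ Θ⊆ (++⁻ʳ Σ γ) c∈ G⊆ , ¬β ∷ [])
  soundness (D-D {Σ = Σ} a Γ _ _ _ d) g (γ , _) with serial g a
  ... | c , c∈ , a∈ = soundness d (good-succs g c∈) (unboxed Γ (++⁻ʳ Σ γ) , [])
    where
    unboxed : ∀ Γ → All (_ ⊩_) (map (D (singleton a)) Γ) → All (proj₂ c ⊩_) Γ
    unboxed []      _            = []
    unboxed (_ ∷ Γ) (f ∷ fs) = f c∈ (λ b∈ → subst (_∈ˢ _) (sym (x∈⁅y⁆⇒x≡y a b∈)) a∈) ∷ unboxed Γ fs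

  -- Invertible propositional rules and induction on weight.

  size : F → ℕ
  size (var _)  = 0
  size ⊥ᶠ       = 0
  size (α ∧ᶠ β) = suc (size α + size β)
  size (α ∨ᶠ β) = suc (size α + size β)
  size (α →ᶠ β) = suc (size α + size β)
  size (¬ᶠ α)   = suc (size α)
  size (D _ α)  = suc (size α)

  weight : List F → ℕ
  weight Γ = sum (map size Γ)

  weight-↭ : ∀ {Γ Γ′} → Γ ↭ Γ′ → weight Γ ≡ weight Γ′
  weight-↭ π = sum-↭ (↭-map⁺ size π)

  weight-++ : ∀ Γ Γ′ → weight (Γ ++ Γ′) ≡ weight Γ + weight Γ′
  weight-++ Γ Γ′ = trans (cong sum (map-++ size Γ Γ′)) (sum-++ (map size Γ) (map size Γ′))

  -- A common format for the propositional rules, with the principal formula in `l` or `r`.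
  -- Invertibility is kept in semantic form: `decompose` passes a refutation up to some premise,
  -- `compose` brings it down from any premise.
  record Rule (l r : List F) : Set₁ where
    field
      premises  : List (List F × List F)
      derive    : ∀ {L Γ Δ} → All (λ s → L ⊢ proj₁ s ++ Γ ⇒ proj₂ s ++ Δ) premises → L ⊢ l ++ Γ ⇒ r ++ Δ
      decompose : ∀ {T} → Refutes T l r → Any (uncurry (Refutes T)) premises
      compose   : All (λ s → ∀ T → uncurry (Refutes T) s → Refutes T l r) premises
      smaller   : All (λ s → weight (proj₁ s) + weight (proj₂ s) < weight l + weight r) premises
      over      : ∀ {P Q} → All (Over P Q) l → All (Over P Q) r →
                  All (λ s → All (Over P Q) (proj₁ s) × All (Over P Q) (proj₂ s)) premises

  private
    -- These inequalities absorb the trailing zeros of sums over lists of one or two formulas.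
    both : ∀ a b → a + (b + 0) ≤ a + b
    both a b = ≤-reflexive (cong (a +_) (+-identityʳ b))

    fst : ∀ a b → a + 0 ≤ a + b
    fst a b = +-monoʳ-≤ a z≤n

    snd : ∀ a b → b + 0 ≤ a + b
    snd a b = ≤-trans (≤-reflexive (+-identityʳ b)) (m≤n+m b a)

    pad : ∀ {a b} → a ≤ b → a + 0 ≤ b + 0 + 0
    pad {b = b} a≤b = ≤-trans (+-mono-≤ a≤b z≤n) (m≤m+n (b + 0) 0)

  Critical : F → Set
  Critical = Passive U

  left-rule : ∀ α → Critical α ⊎ Rule (α ∷ []) []
  left-rule (var _) = inj₁ var
  left-rule ⊥ᶠ      = inj₁ bot
  left-rule (D _ _) = inj₁ (box _)
  left-rule (α ∧ᶠ β) = inj₂ record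
    { premises  = (α ∷ β ∷ [] , []) ∷ []
    ; derive    = λ { (d ∷ []) → L∧ d }
    ; decompose = λ { ((x , y) ∷ [] , []) → here (x ∷ y ∷ [] , []) }
    ; compose   = (λ { _ (x ∷ y ∷ [] , []) → (x , y) ∷ [] , [] }) ∷ []
    ; smaller   = s≤s (pad (both (size α) (size β))) ∷ []
    ; over      = λ { ((v , w) ∷ []) [] → ((v ∘ inj₁ , w ∘ inj₁) ∷ (v ∘ inj₂ , w ∘ inj₂) ∷ [] , []) ∷ [] }
    }
  left-rule (α ∨ᶠ β) = inj₂ record
    { premises  = (α ∷ [] , []) ∷ (β ∷ [] , []) ∷ []
    ; derive    = λ { (d ∷ e ∷ []) → L∨ d e }
    ; decompose = λ { (inj₁ x ∷ [] , []) → here (x ∷ [] , []) ; (inj₂ y ∷ [] , []) → there (here (y ∷ [] , [])) }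
    ; compose   = (λ { _ (x ∷ [] , []) → inj₁ x ∷ [] , [] }) ∷ (λ { _ (y ∷ [] , []) → inj₂ y ∷ [] , [] }) ∷ []
    ; smaller   = s≤s (pad (fst (size α) (size β))) ∷ s≤s (pad (snd (size α) (size β))) ∷ []
    ; over      = λ { ((v , w) ∷ []) [] → ((v ∘ inj₁ , w ∘ inj₁) ∷ [] , []) ∷ ((v ∘ inj₂ , w ∘ inj₂) ∷ [] , []) ∷ [] }
    }
  left-rule (α →ᶠ β) = inj₂ record
    { premises  = ([] , α ∷ []) ∷ (β ∷ [] , []) ∷ []
    ; derive    = λ { (d ∷ e ∷ []) → L→ d e }
    ; decompose = λ { {T} (f ∷ [] , []) → dec-→ (T ⊩? α) f }
    ; compose   = (λ { _ ([] , ¬x ∷ []) → (λ x → contradiction x ¬x) ∷ [] , [] }) ∷ (λ { _ (y ∷ [] , []) → (λ _ → y) ∷ [] , [] }) ∷ []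
    ; smaller   = s≤s (≤-trans (fst (size α) (size β)) (≤-trans (m≤m+n _ 0) (m≤m+n _ 0))) ∷ s≤s (pad (snd (size α) (size β))) ∷ []
    ; over      = λ { ((v , w) ∷ []) [] → ([] , (v ∘ inj₁ , w ∘ inj₁) ∷ []) ∷ ((v ∘ inj₂ , w ∘ inj₂) ∷ [] , []) ∷ [] }
    }
    where
    dec-→ : ∀ {T} → Dec (T ⊩ α) → (T ⊩ α → T ⊩ β) → Any (uncurry (Refutes T)) (([] , α ∷ []) ∷ (β ∷ [] , []) ∷ [])
    dec-→ (yes x) f = there (here (f x ∷ [] , []))
    dec-→ (no ¬x) f = here ([] , ¬x ∷ [])
  left-rule (¬ᶠ α) = inj₂ record
    { premises  = ([] , α ∷ []) ∷ []
    ; derive    = λ { (d ∷ []) → L¬ d }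
    ; decompose = λ { (¬x ∷ [] , []) → here ([] , ¬x ∷ []) }
    ; compose   = (λ { _ ([] , ¬x ∷ []) → ¬x ∷ [] , [] }) ∷ []
    ; smaller   = s≤s (m≤m+n _ 0) ∷ []
    ; over      = λ { (o ∷ []) [] → ([] , o ∷ []) ∷ [] }
    }

  right-rule : ∀ α → Critical α ⊎ Rule [] (α ∷ [])
  right-rule (var _) = inj₁ var
  right-rule ⊥ᶠ      = inj₁ bot
  right-rule (D _ _) = inj₁ (box _)
  right-rule (α ∧ᶠ β) = inj₂ record
    { premises  = ([] , α ∷ []) ∷ ([] , β ∷ []) ∷ []
    ; derive    = λ { (d ∷ e ∷ []) → R∧ d e }
    ; decompose = λ { {T} ([] , ¬xy ∷ []) → dec-∧ (T ⊩? α) ¬xy }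
    ; compose   = (λ { _ ([] , ¬x ∷ []) → [] , (¬x ∘ proj₁) ∷ [] }) ∷ (λ { _ ([] , ¬y ∷ []) → [] , (¬y ∘ proj₂) ∷ [] }) ∷ []
    ; smaller   = s≤s (≤-trans (fst (size α) (size β)) (m≤m+n _ 0)) ∷ s≤s (≤-trans (snd (size α) (size β)) (m≤m+n _ 0)) ∷ []
    ; over      = λ { [] ((v , w) ∷ []) → ([] , (v ∘ inj₁ , w ∘ inj₁) ∷ []) ∷ ([] , (v ∘ inj₂ , w ∘ inj₂) ∷ []) ∷ [] }
    }
    where
    dec-∧ : ∀ {T} → Dec (T ⊩ α) → ¬ (T ⊩ α × T ⊩ β) → Any (uncurry (Refutes T)) (([] , α ∷ []) ∷ ([] , β ∷ []) ∷ [])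
    dec-∧ (yes x) ¬xy = there (here ([] , (λ y → ¬xy (x , y)) ∷ []))
    dec-∧ (no ¬x) ¬xy = here ([] , ¬x ∷ [])
  right-rule (α ∨ᶠ β) = inj₂ record
    { premises  = ([] , α ∷ β ∷ []) ∷ []
    ; derive    = λ { (d ∷ []) → R∨ d }
    ; decompose = λ { ([] , ¬xy ∷ []) → here ([] , (¬xy ∘ inj₁) ∷ (¬xy ∘ inj₂) ∷ []) }
    ; compose   = (λ { _ ([] , ¬x ∷ ¬y ∷ []) → [] , (λ { (inj₁ x) → ¬x x ; (inj₂ y) → ¬y y }) ∷ [] }) ∷ []
    ; smaller   = s≤s (≤-trans (both (size α) (size β)) (m≤m+n _ 0)) ∷ []
    ; over      = λ { [] ((v , w) ∷ []) → ([] , (v ∘ inj₁ , w ∘ inj₁) ∷ (v ∘ inj₂ , w ∘ inj₂) ∷ []) ∷ [] }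
    }
  right-rule (α →ᶠ β) = inj₂ record
    { premises  = (α ∷ [] , β ∷ []) ∷ []
    ; derive    = λ { (d ∷ []) → R→ d }
    ; decompose = λ { {T} ([] , ¬f ∷ []) →
        here (stable α (λ ¬x → ¬f (λ x → contradiction x ¬x)) ∷ [] , (λ y → ¬f (λ _ → y)) ∷ []) }
    ; compose   = (λ { _ (x ∷ [] , ¬y ∷ []) → [] , (λ f → ¬y (f x)) ∷ [] }) ∷ []
    ; smaller   = s≤s (≤-trans (≤-reflexive (cong₂ _+_ (+-identityʳ (size α)) (+-identityʳ (size β)))) (m≤m+n _ 0)) ∷ []
    ; over      = λ { [] ((v , w) ∷ []) → ((v ∘ inj₁ , w ∘ inj₁) ∷ [] , (v ∘ inj₂ , w ∘ inj₂) ∷ []) ∷ [] }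
    }
  right-rule (¬ᶠ α) = inj₂ record
    { premises  = (α ∷ [] , []) ∷ []
    ; derive    = λ { (d ∷ []) → R¬ d }
    ; decompose = λ { ([] , ¬¬x ∷ []) → here (stable α ¬¬x ∷ [] , []) }
    ; compose   = (λ { _ (x ∷ [] , []) → [] , (λ ¬x → ¬x x) ∷ [] }) ∷ []
    ; smaller   = s≤s (≤-reflexive (+-identityʳ _)) ∷ []
    ; over      = λ { [] (o ∷ []) → (o ∷ [] , []) ∷ [] }
    }

  extract : ∀ {ℓ} {P : F → Set ℓ} → (∀ α → Critical α ⊎ P α) → ∀ Γ →
            All Critical Γ ⊎ (∃[ α ] ∃[ Γ′ ] Γ ↭ α ∷ Γ′ × P α)
  extract f [] = inj₁ []
  extract f (α ∷ Γ) with f α | extract f Γ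
  ... | inj₂ x | _                        = inj₂ (α , Γ , ↭-refl , x)
  ... | inj₁ c | inj₁ cs                  = inj₁ (c ∷ cs)
  ... | inj₁ c | inj₂ (β , Γ′ , π , x) = inj₂ (β , α ∷ Γ′ , ↭-trans (prep α π) (swap α β ↭-refl) , x)

  -- One induction for two uses, deciding a sequent and interpolating it. The critical case may call
  -- on every lighter sequent, because the sequents arising at successors are not premises of a
  -- `Rule`.
  module _ {ℓ : Level} (P : List F → List F → Set ℓ)
    (permute : ∀ {Γ Γ′ Δ Δ′} → Γ ↭ Γ′ → Δ ↭ Δ′ → P Γ Δ → P Γ′ Δ′)
    (reduce : ∀ {l r Γ Δ} (ρ : Rule l r) → All (λ s → P (proj₁ s ++ Γ) (proj₂ s ++ Δ)) (Rule.premises ρ) → P (l ++ Γ) (r ++ Δ))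
    (critical : ∀ {Γ Δ} → All Critical Γ → All Critical Δ →
                (∀ Γ′ Δ′ → weight Γ′ + weight Δ′ < weight Γ + weight Δ → P Γ′ Δ′) → P Γ Δ)
    where

    private
      regroup : ∀ l r Γ Δ → weight (l ++ Γ) + weight (r ++ Δ) ≡ (weight l + weight r) + (weight Γ + weight Δ)
      regroup l r Γ Δ rewrite weight-++ l Γ | weight-++ r Δ = shuffle (weight l) (weight r) (weight Γ) (weight Δ)
        where
        shuffle : ∀ a b c d → (a + c) + (b + d) ≡ (a + b) + (c + d)
        shuffle = solve-∀

      context : ∀ l r X Y Γ Δ → weight X + weight Y < weight l + weight r →
                weight (X ++ Γ) + weight (Y ++ Δ) < weight (l ++ Γ) + weight (r ++ Δ)
      context l r X Y Γ Δ lt rewrite regroup l r Γ Δ | regroup X Y Γ Δ = +-monoˡ-< (weight Γ + weight Δ) lt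

      search-acc : ∀ Γ Δ → Acc _<_ (weight Γ + weight Δ) → P Γ Δ
      search-acc Γ Δ (acc rs) with extract left-rule Γ | extract right-rule Δ
      ... | inj₁ cΓ | inj₁ cΔ = critical cΓ cΔ (λ Γ′ Δ′ lt → search-acc Γ′ Δ′ (rs lt))
      ... | inj₂ (α , Γ′ , π , ρ) | _ = permute (↭-sym π) ↭-refl (reduce ρ (All.map (λ {s} lt →
        search-acc _ _ (rs (≤-trans (context (α ∷ []) [] (proj₁ s) (proj₂ s) Γ′ Δ lt) (≤-reflexive (cong (_+ weight Δ) (sym (weight-↭ π))))))) (Rule.smaller ρ)))
      ... | inj₁ _ | inj₂ (α , Δ′ , π , ρ) = permute ↭-refl (↭-sym π) (reduce ρ (All.map (λ {s} lt →
        search-acc _ _ (rs (≤-trans (context [] (α ∷ []) (proj₁ s) (proj₂ s) Γ Δ′ lt) (≤-reflexive (cong (weight Γ +_) (sym (weight-↭ π))))))) (Rule.smaller ρ)))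

    search : ∀ Γ Δ → P Γ Δ
    search Γ Δ = search-acc Γ Δ (<-wellFounded _)


  -- Boxed formulas and the modal rules on critical sequents.

  boxes : List F → List (Grp n × F)
  boxes []            = []
  boxes (D G α ∷ Γ) = (G , α) ∷ boxes Γ
  boxes (_ ∷ Γ)       = boxes Γ

  ∈-boxes⁺ : ∀ {Γ G α} → All Critical Γ → D G α ∈ Γ → (G , α) ∈ boxes Γ
  ∈-boxes⁺ (box _ ∷ _)  (here refl) = here refl
  ∈-boxes⁺ (var ∷ c)    (there ∈Γ)  = ∈-boxes⁺ c ∈Γ
  ∈-boxes⁺ (bot ∷ c)    (there ∈Γ)  = ∈-boxes⁺ c ∈Γ
  ∈-boxes⁺ (box _ ∷ c)  (there ∈Γ)  = there (∈-boxes⁺ c ∈Γ)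

  ∈-boxes⁻ : ∀ {Γ G α} → All Critical Γ → (G , α) ∈ boxes Γ → D G α ∈ Γ
  ∈-boxes⁻ (var ∷ c)   ∈b          = there (∈-boxes⁻ c ∈b)
  ∈-boxes⁻ (bot ∷ c)   ∈b          = there (∈-boxes⁻ c ∈b)
  ∈-boxes⁻ (box _ ∷ c) (here refl) = here refl
  ∈-boxes⁻ (box _ ∷ c) (there ∈b)  = there (∈-boxes⁻ c ∈b)

  boxes-within : Subset n → List F → List (Grp n × F)
  boxes-within G Γ = filter (λ θ → value (proj₁ θ) ⊆? G) (boxes Γ)

  -- The antecedent of the premise of `D-K`. `G` ranges over all subsets, since it is also
  -- instantiated with edge labels and with unions of groups.
  unbox : Subset n → List F → List F
  unbox G Γ = map proj₂ (boxes-within G Γ)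

  ∈-unbox⁺ : ∀ {Γ G H α} → (H , α) ∈ boxes Γ → value H ⊆ˢ G → α ∈ unbox G Γ
  ∈-unbox⁺ ∈b H⊆ = ∈-map⁺ proj₂ (∈-filter⁺ _ ∈b (λ {x} → H⊆ {x}))

  ∈-unbox⁻ : ∀ {Γ G α} → α ∈ unbox G Γ → ∃[ H ] (H , α) ∈ boxes Γ × value H ⊆ˢ G
  ∈-unbox⁻ {Γ} {G} ∈u with ∈-map⁻ proj₂ ∈u
  ... | (H , α) , ∈f , refl with ∈-filter⁻ (λ θ → value (proj₁ θ) ⊆? G) {xs = boxes Γ} ∈f
  ...   | ∈b , H⊆ = H , ∈b , H⊆

  -- Each unboxed formula loses one `D`, worth one unit of `size`. The summand `length` records this
  -- gain; it makes the drop strict in `unbox-smaller`, where no box of the succedent is consumed.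
  unbox-weight : ∀ {Γ} G → All Critical Γ → length (unbox G Γ) + weight (unbox G Γ) ≤ weight Γ
  unbox-weight G []        = z≤n
  unbox-weight G (var ∷ c) = unbox-weight G c
  unbox-weight G (bot ∷ c) = unbox-weight G c
  unbox-weight {D H γ ∷ Γ} G (box _ ∷ c) with value H ⊆? G
  ... | no  _ = m≤n⇒m≤1+n (≤-trans (unbox-weight G c) (m≤n+m _ (size γ)))
  ... | yes _ = s≤s (begin
    length (unbox G Γ) + (size γ + weight (unbox G Γ)) ≡⟨ exchange (length (unbox G Γ)) (size γ) (weight (unbox G Γ)) ⟩
    size γ + (length (unbox G Γ) + weight (unbox G Γ)) ≤⟨ +-monoʳ-≤ (size γ) (unbox-weight G c) ⟩
    size γ + weight Γ ∎)
    where
    open ≤-Reasoning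
    exchange : ∀ a b c → a + (b + c) ≡ b + (a + c)
    exchange = solve-∀

  box-weight : ∀ {Δ G β} → All Critical Δ → (G , β) ∈ boxes Δ → size β + 0 < weight Δ
  box-weight (var ∷ c) ∈b = box-weight c ∈b
  box-weight (bot ∷ c) ∈b = box-weight c ∈b
  box-weight {D _ β ∷ _} (box _ ∷ c) (here refl) = s≤s (+-monoʳ-≤ (size β) z≤n)
  box-weight {D _ γ ∷ _} (box _ ∷ c) (there ∈b)  = m≤n⇒m≤1+n (≤-trans (box-weight c ∈b) (m≤n+m _ (size γ)))

  demand-smaller : ∀ {Γ Δ G H β} → All Critical Γ → All Critical Δ → (H , β) ∈ boxes Δ →
                   weight (unbox G Γ) + (size β + 0) < weight Γ + weight Δ
  demand-smaller {Γ} {G = G} cΓ cΔ ∈b = +-mono-≤-<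
    (≤-trans (m≤n+m (weight (unbox G Γ)) (length (unbox G Γ))) (unbox-weight G cΓ)) (box-weight cΔ ∈b)

  unbox-smaller : ∀ {Γ G} (Δ : List F) → All Critical Γ → unbox G Γ ≢ [] → weight (unbox G Γ) + 0 < weight Γ + weight Δ
  unbox-smaller {Γ} {G} Δ cΓ ne with unbox G Γ | unbox-weight G cΓ
  ... | []    | _  = contradiction refl ne
  ... | α ∷ Θ | le = +-mono-<-≤ (≤-trans (s≤s (m≤n+m (weight (α ∷ Θ)) (length Θ))) le) z≤n

  -- A box left in `Σ` fails the test `value H ⊆? G`, which is the side condition of `D-K`; so the
  -- rule applies with every usable box principal.
  separate : ∀ {Γ} G → All Critical Γ → ∃[ Σ ] Γ ↭ Σ ++ map (uncurry D) (boxes-within G Γ) ×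
             All (Passive (λ H → value H ⊈ˢ G)) Σ
  separate G [] = [] , ↭-refl , []
  separate G (var ∷ c) with separate G c
  ... | Σ , π , ps = _ ∷ Σ , prep _ π , var ∷ ps
  separate G (bot ∷ c) with separate G c
  ... | Σ , π , ps = _ ∷ Σ , prep _ π , bot ∷ ps
  separate {D H γ ∷ Γ} G (box _ ∷ c) with value H ⊆? G | separate G c
  ... | yes _  | Σ , π , ps = Σ , ↭-trans (prep _ π) (↭-sym (shift _ Σ _)) , ps
  ... | no H⊈ | Σ , π , ps = _ ∷ Σ , prep _ π , box (λ H⊆ → H⊈ H⊆) ∷ ps

  derive-box : ∀ {L Γ Δ G β} → All Critical Γ → All Critical Δ → (G , β) ∈ boxes Δ →
               L ⊢ unbox (value G) Γ ⇒ β ∷ [] → L ⊢ Γ ⇒ Δ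
  derive-box {Γ = Γ} {G = G} cΓ cΔ ∈b d with separate (value G) cΓ | ∈⇒↭ (∈-boxes⁻ cΔ ∈b)
  ... | Σ , π , ps | Ω , ρ with All-resp-↭ ρ cΔ
  ...   | _ ∷ cΩ = perm (↭-sym π) (↭-sym ρ)
    (D-K (boxes-within (value G) Γ) (all-filter (λ θ → value (proj₁ θ) ⊆? value G) (boxes Γ)) ps cΩ d)

  -- Groups are nonempty, and irrelevance lifts equality of members to equality of groups. Hence
  -- unboxing at `⁅ b ⁆` finds precisely the formulas principal in `D-D`.
  ⊆-singleton : ∀ (H : Grp n) {b} → value H ⊆ˢ ⁅ b ⁆ → H ≡ singleton b
  ⊆-singleton H {b} H⊆ = value-injective (⊆-antisym H⊆ b∈H)
    where
    b∈H : ⁅ b ⁆ ⊆ˢ value H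
    b∈H c∈ with x∈⁅y⁆⇒x≡y b c∈ | nonempty H
    ... | refl | d , d∈ with x∈⁅y⁆⇒x≡y b (H⊆ d∈)
    ...   | refl = d∈

  derive-serial : ∀ {Γ Δ} b → All Critical Γ → All Critical Δ → unbox ⁅ b ⁆ Γ ≢ [] →
                  KD-D ⊢ unbox ⁅ b ⁆ Γ ⇒ [] → KD-D ⊢ Γ ⇒ Δ
  derive-serial {Γ} b cΓ cΔ ne d with separate ⁅ b ⁆ cΓ
  ... | Σ , π , ps = perm (↭-sym (↭-trans π (++⁺ˡ Σ (↭-reflexive
      (relabel (all-filter (λ θ → value (proj₁ θ) ⊆? ⁅ b ⁆) (boxes Γ))))))) ↭-refl
      (D-D b (unbox ⁅ b ⁆ Γ) ne (All.map weaken ps) cΔ d)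
    where
    weaken : ∀ {α : F} → Passive (λ H → value H ⊈ˢ ⁅ b ⁆) α → Passive (λ H → value H ≢ ⁅ b ⁆) α
    weaken var = var
    weaken bot = bot
    weaken (box {H = H} ⊈) = box (λ eq → ⊈ (λ {x} → subst (x ∈ˢ_) eq))

    relabel : ∀ {Θ : List (Grp n × F)} → All (λ θ → value (proj₁ θ) ⊆ˢ ⁅ b ⁆) Θ →
              map (uncurry D) Θ ≡ map (D (singleton b)) (map proj₂ Θ)
    relabel [] = refl
    relabel {(H , _) ∷ _} (H⊆ ∷ ⊆s) = cong₂ _∷_ (cong (λ G → D G _) (⊆-singleton H H⊆)) (relabel ⊆s)

  unbox-forced : ∀ {T Γ c} G → All Critical Γ → All (T ⊩_) Γ → c ∈ succs T → G ⊆ˢ proj₁ c →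
                 All (proj₂ c ⊩_) (unbox G Γ)
  unbox-forced {Γ = Γ} G cΓ fs c∈ G⊆ = All.tabulate λ ∈u → let H , ∈b , H⊆ = ∈-unbox⁻ {Γ} ∈u in
    All.lookup fs (∈-boxes⁻ cΓ ∈b) c∈ (G⊆ ∘ H⊆)

  ¬box⇒succ : ∀ {T : Tree} {G} {β : F} → ¬ (T ⊩ D G β) → ∃[ c ] c ∈ succs T × value G ⊆ˢ proj₁ c × ¬ (proj₂ c ⊩ β)
  ¬box⇒succ {T} {G} {β} ¬f with any? (λ c → (value G ⊆? proj₁ c) ×-dec ¬? (proj₂ c ⊩? β)) (succs T)
  ... | yes any = find any
  ... | no none = ⊥-elim (¬f (λ c∈ G⊆ → stable β (λ ¬β → none (lose c∈ ((λ {x} → G⊆ {x}) , ¬β)))))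

  -- Local conditions for a new root, used for completeness and for amalgamation alike. A box `D H`
  -- looks along the edges whose label includes `H`, so a child owes `Γ` the formulas unboxed at its
  -- own label.
  refutes-node : ∀ {Γ Δ v cs} → All Critical Γ → All Critical Δ → ⊥ᶠ ∉ˡ Γ →
    (∀ {q} → var q ∈ Γ → v q ≡ true) → (∀ {q} → var q ∈ Δ → v q ≢ true) →
    All (λ c → All (proj₂ c ⊩_) (unbox (proj₁ c) Γ)) cs →
    All (λ θ → ∃[ c ] c ∈ cs × value (proj₁ θ) ⊆ˢ proj₁ c × ¬ (proj₂ c ⊩ proj₂ θ)) (boxes Δ) →
    Refutes (node v cs) Γ Δ
  refutes-node {Γ} {Δ} {v} {cs} cΓ cΔ ⊥∉ vΓ vΔ inv wit = All.tabulate (λ ∈Γ → left (All.lookup cΓ ∈Γ) ∈Γ)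
                                                       , All.tabulate (λ ∈Δ → right (All.lookup cΔ ∈Δ) ∈Δ)
    where
    left : ∀ {γ} → Critical γ → γ ∈ Γ → node v cs ⊩ γ
    left var     ∈Γ = vΓ ∈Γ
    left bot     ∈Γ = ⊥∉ ∈Γ
    left (box _) ∈Γ = λ c∈ H⊆ → All.lookup (All.lookup inv c∈) (∈-unbox⁺ {Γ} (∈-boxes⁺ cΓ ∈Γ) H⊆)

    right : ∀ {δ} → Critical δ → δ ∈ Δ → ¬ (node v cs ⊩ δ)
    right var     ∈Δ = vΔ ∈Δ
    right bot     ∈Δ = id
    right (box _) ∈Δ f with All.lookup wit (∈-boxes⁺ cΔ ∈Δ)
    ... | c , c∈ , G⊆ , ¬β = ¬β (f c∈ G⊆)

  -- Countermodels demanded by a critical sequent, and unions of groups.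

  CounterModel : Logic → List F → List F → Set
  CounterModel L Γ Δ = ∃[ T ] Good L T × Refutes T Γ Δ

  serial-demands : Logic → List (Subset n × List F)
  serial-demands K-D  = []
  serial-demands KD-D = map (λ b → ⁅ b ⁆ , []) (allFin n)

  -- The successors a countermodel of a critical sequent must have: one
  -- refuting each boxed formula of Δ and, for KD-D, one for every agent.
  demands : Logic → List F → List (Subset n × List F)
  demands L Δ = map (λ θ → value (proj₁ θ) , proj₂ θ ∷ []) (boxes Δ) ++ serial-demands L

  Decision : Logic → List F → List F → Set
  Decision L Γ Δ = L ⊢ Γ ⇒ Δ ⊎ CounterModel L Γ Δ

  box-demand : ∀ {L} {Γ Δ : List F} → All Critical Γ → All Critical Δ →
    (∀ Γ′ Δ′ → weight Γ′ + weight Δ′ < weight Γ + weight Δ → Decision L Γ′ Δ′) →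
    ∀ {θ} → θ ∈ boxes Δ → L ⊢ Γ ⇒ Δ ⊎ CounterModel L (unbox (value (proj₁ θ)) Γ) (proj₂ θ ∷ [])
  box-demand {Γ = Γ} cΓ cΔ rec {G , β} ∈b with rec (unbox (value G) Γ) (β ∷ []) (demand-smaller {G = value G} cΓ cΔ ∈b)
  ... | inj₁ d = inj₁ (derive-box cΓ cΔ ∈b d)
  ... | inj₂ m = inj₂ m

  serial-demand : ∀ {Γ Δ : List F} → All Critical Γ → All Critical Δ →
    (∀ Γ′ Δ′ → weight Γ′ + weight Δ′ < weight Γ + weight Δ → Decision KD-D Γ′ Δ′) →
    ∀ b → KD-D ⊢ Γ ⇒ Δ ⊎ CounterModel KD-D (unbox ⁅ b ⁆ Γ) []
  serial-demand {Γ} {Δ} cΓ cΔ rec b with unbox ⁅ b ⁆ Γ | unbox-smaller {G = ⁅ b ⁆} Δ cΓ | derive-serial {Δ = Δ} b cΓ cΔ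
  -- `D-D` needs a nonempty antecedent; with nothing unboxed the demand is empty and `loop` meets
  -- it.
  ... | []        | _  | _      = inj₂ (loop , loop , [] , [])
  ... | Θ@(_ ∷ _) | lt | derive with rec Θ [] (lt λ ())
  ...   | inj₁ d = inj₁ (derive (λ ()) d)
  ...   | inj₂ m = inj₂ m

  complete-demands : ∀ {L} {Γ Δ : List F} → All Critical Γ → All Critical Δ →
    (∀ Γ′ Δ′ → weight Γ′ + weight Δ′ < weight Γ + weight Δ → Decision L Γ′ Δ′) →
    All (λ d → L ⊢ Γ ⇒ Δ ⊎ CounterModel L (unbox (proj₁ d) Γ) (proj₂ d)) (demands L Δ)
  complete-demands {K-D}  cΓ cΔ rec = ++⁺ (All-map⁺ (All.tabulate (box-demand cΓ cΔ rec))) []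
  complete-demands {KD-D} cΓ cΔ rec = ++⁺ (All-map⁺ (All.tabulate (box-demand cΓ cΔ rec)))
    (All-map⁺ (All.tabulate (λ {b} _ → serial-demand cΓ cΔ rec b)))

  bot? : ∀ (α : F) → Dec (⊥ᶠ ≡ α)
  bot? (var r)  = no λ ()
  bot? ⊥ᶠ       = yes refl
  bot? (_ ∧ᶠ _) = no λ ()
  bot? (_ ∨ᶠ _) = no λ ()
  bot? (_ →ᶠ _) = no λ ()
  bot? (¬ᶠ _)   = no λ ()
  bot? (D _ _)  = no λ ()


  -- The groups K that may label boxes of the interpolant: G itself need not
  -- consist of agents of Γ, but support G Θ does and unboxes the same formulas.
  unions : List (Grp n × F) → List (Subset n)
  unions []            = ⊥ˢ ∷ []
  unions ((H , _) ∷ Θ) = unions Θ ++ map (value H ∪ˢ_) (unions Θ)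

  unions⁻ : ∀ {K b} Θ → K ∈ unions Θ → b ∈ˢ K → ∃[ θ ] θ ∈ Θ × b ∈ˢ value (proj₁ θ)
  unions⁻ [] (here refl) b∈ = contradiction b∈ ∉⊥
  unions⁻ ((H , α) ∷ Θ) K∈ b∈ with ∈-++⁻ (unions Θ) K∈
  ... | inj₁ K∈Θ = let θ , θ∈ , b∈θ = unions⁻ Θ K∈Θ b∈ in θ , there θ∈ , b∈θ
  ... | inj₂ K∈m with ∈-map⁻ (value H ∪ˢ_) K∈m
  ...   | K′ , K′∈ , refl with x∈p∪q⁻ (value H) K′ b∈
  ...     | inj₁ b∈H  = (H , α) , here refl , b∈H
  ...     | inj₂ b∈K′ = let θ , θ∈ , b∈θ = unions⁻ Θ K′∈ b∈K′ in θ , there θ∈ , b∈θ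

  -- Take the union of exactly those groups of `Θ` that lie within `G`.
  support : ∀ G (Θ : List (Grp n × F)) → ∃[ K ] K ∈ unions Θ × K ⊆ˢ G ×
            (∀ {H α} → (H , α) ∈ Θ → value H ⊆ˢ G → value H ⊆ˢ K)
  support G [] = ⊥ˢ , here refl , (λ b∈ → contradiction b∈ ∉⊥) , λ ()
  support G ((H , α) ∷ Θ) with support G Θ | value H ⊆? G
  ... | K , K∈ , K⊆ , max | no H⊈ = K , ∈-++⁺ˡ K∈ , K⊆ , λ
    { (here refl) H⊆ → ⊥-elim (H⊈ H⊆) ; (there ∈Θ) → max ∈Θ }
  ... | K , K∈ , K⊆ , max | yes H⊆ = value H ∪ˢ K , ∈-++⁺ʳ (unions Θ) (∈-map⁺ _ K∈)
    , (λ b∈ → [ H⊆ , K⊆ ]′ (x∈p∪q⁻ (value H) K b∈)) , λ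
    { (here refl) _ b∈ → x∈p∪q⁺ (inj₁ b∈) ; (there ∈Θ) H′⊆ b∈ → x∈p∪q⁺ {p = value H} (inj₂ (max ∈Θ H′⊆ b∈)) }

  unbox≢[]⇒nonempty : ∀ {Γ : List F} {G} → unbox G Γ ≢ [] → Nonempty G
  unbox≢[]⇒nonempty {Γ} {G} ne with unbox G Γ | ∈-unbox⁻ {Γ = Γ} {G}
  ... | []    | _   = contradiction refl ne
  ... | _ ∷ _ | inv = let H , _ , H⊆ = inv (here refl) ; b , b∈ = nonempty H in b , H⊆ b∈

  unbox-over : ∀ {P Q} {Γ : List F} G → All Critical Γ → All (Over P Q) Γ → All (Over P Q) (unbox G Γ)
  unbox-over {Γ = Γ} G cΓ oΓ = All.tabulate λ ∈u → let H , ∈b , _ = ∈-unbox⁻ {Γ = Γ} {G} ∈u ; v , w = All.lookup oΓ (∈-boxes⁻ cΓ ∈b) in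
    v , w ∘ inj₂

-- Decidability of provability and completeness for trees.

module _ {n : ℕ} {Atom : Set} (_≟_ : DecidableEquality Atom) where

  private
    F : Set
    F = Formula n Atom

  var? : ∀ q (α : F) → Dec (var q ≡ α)
  var? q (var r)  = map′ (cong var) (λ { refl → refl }) (q ≟ r)
  var? q ⊥ᶠ       = no λ ()
  var? q (_ ∧ᶠ _) = no λ ()
  var? q (_ ∨ᶠ _) = no λ ()
  var? q (_ →ᶠ _) = no λ ()
  var? q (¬ᶠ _)   = no λ ()
  var? q (D _ _)  = no λ ()

  _var∈?_ : ∀ q (Γ : List F) → Dec (var q ∈ Γ)
  q var∈? Γ = any? (var? q) Γ

  shared? : ∀ (Γ : List F) {Δ : List F} → All Critical Δ → (∃[ q ] var q ∈ Γ × var q ∈ Δ) ⊎ (∀ {q} → var q ∈ Δ → var q ∉ˡ Γ)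
  shared? Γ [] = inj₂ λ ()
  shared? Γ (c ∷ cs) with shared? Γ cs
  ... | inj₁ (q , ∈Γ , ∈Δ) = inj₁ (q , ∈Γ , there ∈Δ)
  shared? Γ (bot ∷ cs)   | inj₂ f = inj₂ λ { (there ∈Δ) → f ∈Δ }
  shared? Γ (box _ ∷ cs) | inj₂ f = inj₂ λ { (there ∈Δ) → f ∈Δ }
  shared? Γ (var {q} ∷ cs) | inj₂ f with q var∈? Γ
  ... | yes ∈Γ = inj₁ (q , ∈Γ , here refl)
  ... | no  ∉Γ = inj₂ λ { (here refl) → ∉Γ ; (there ∈Δ) → f ∈Δ }

  -- Backward search. At a critical sequent that is not initial, a derivation answering one demand
  -- extends by a modal rule; if every demand has a countermodel, these become the children of a new
  -- root.
  completeness : ∀ L Γ Δ → Decision L Γ Δ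
  completeness L = search (Decision L) permute reduce critical
    where
    permute : ∀ {Γ Γ′ Δ Δ′ : List F} → Γ ↭ Γ′ → Δ ↭ Δ′ → Decision L Γ Δ → Decision L Γ′ Δ′
    permute π ρ (inj₁ d)           = inj₁ (perm π ρ d)
    permute π ρ (inj₂ (T , g , r)) = inj₂ (T , g , refutes-↭ π ρ r)

    reduce : ∀ {l r Γ Δ : List F} (ρ : Rule l r) →
             All (λ s → Decision L (proj₁ s ++ Γ) (proj₂ s ++ Δ)) (Rule.premises ρ) → Decision L (l ++ Γ) (r ++ Δ)
    reduce {l} {r} {Γ} {Δ} ρ ds with sequence (All.zipWith refuted (Rule.compose ρ , ds))
      where
      refuted : ∀ {s} → (∀ T → uncurry (Refutes T) s → Refutes T l r) × Decision L (proj₁ s ++ Γ) (proj₂ s ++ Δ) →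
                CounterModel L (l ++ Γ) (r ++ Δ) ⊎ (L ⊢ proj₁ s ++ Γ ⇒ proj₂ s ++ Δ)
      refuted (_ , inj₁ d) = inj₂ d
      refuted {X , Y} (compose , inj₂ (T , g , ref)) with refutes-++⁻ X Y ref
      ... | refXY , refΓΔ = inj₁ (T , g , refutes-++⁺ (compose T refXY) refΓΔ)
    ... | inj₁ m  = inj₂ m
    ... | inj₂ ds′ = inj₁ (Rule.derive ρ ds′)

    serial-node : ∀ {Δ : List F} L′ {cs : List (Subset n × Tree {n} {Atom})} →
      All (λ d → ∃[ c ] c ∈ cs × proj₁ d ≡ proj₁ c) (demands L′ Δ) → L′ ≡ KD-D → ∀ b → ∃[ c ] c ∈ cs × b ∈ˢ proj₁ c
    serial-node {Δ} KD-D f _ b with All.lookup f (∈-++⁺ʳ (map _ (boxes Δ)) (∈-map⁺ _ (∈-allFin b)))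
    ... | c , c∈ , refl = c , c∈ , x∈⁅x⁆ b

    critical : ∀ {Γ Δ : List F} → All Critical Γ → All Critical Δ →
      (∀ Γ′ Δ′ → weight Γ′ + weight Δ′ < weight Γ + weight Δ → Decision L Γ′ Δ′) → Decision L Γ Δ
    critical {Γ} {Δ} cΓ cΔ rec with any? (bot? {n} {Atom}) Γ | shared? Γ cΔ | sequence (complete-demands cΓ cΔ rec)
    ... | yes ⊥∈ | _ | _ = inj₁ (perm (↭-sym (proj₂ (∈⇒↭ ⊥∈))) ↭-refl L⊥)
    ... | no _ | inj₁ (q , ∈Γ , ∈Δ) | _ = inj₁ (perm (↭-sym (proj₂ (∈⇒↭ ∈Γ))) (↭-sym (proj₂ (∈⇒↭ ∈Δ))) init)
    ... | no _ | inj₂ _ | inj₁ d = inj₁ d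
    ... | no ⊥∉ | inj₂ unshared | inj₂ ms
      with choose {R = λ (d : Subset n × List F) (c : Subset n × Tree {n} {Atom}) → proj₁ d ≡ proj₁ c × Good L (proj₂ c) × Refutes (proj₂ c) (unbox (proj₁ d) Γ) (proj₂ d)}
                  (All.map (λ {d} (T , g , r) → (proj₁ d , T) , refl , g , r) ms)
    -- The root makes true exactly the variables of `Γ`; each child is labelled by the agents of its
    -- demand.
    ...   | cs , f , b = inj₂ (node (λ q → does (q var∈? Γ)) cs
      , node (serial-node {Δ} L (All.map (λ (c , c∈ , eq , _) → c , c∈ , eq) f)) (All.map (λ (_ , _ , _ , g , _) → g) b)
      , refutes-node cΓ cΔ ⊥∉ (dec-true (_ var∈? Γ)) (λ ∈Δ → unshared ∈Δ ∘ does⇒ (_ var∈? Γ)) (All.map (λ { (_ , _ , refl , _ , r , _) → r }) b)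
          (All.tabulate (λ ∈b → let c , c∈ , eq , _ , _ , r = All.lookup f (∈-++⁺ˡ (∈-map⁺ _ ∈b)) in
             c , c∈ , (λ {x} → subst (x ∈ˢ_) eq) , All.head r)))

  -- Agreement of trees on formulas without `p` and `a`.

  module _ (L : Logic) (p : Atom) (a : Fin n) where

    private
      Tr : Set
      Tr = Tree {n} {Atom}

    infix 4 _≈_

    _≈_ : Tr → Tr → Set
    S ≈ T = ∀ α → Over (p ≢_) (a ≢_) α → (S ⊩ α → T ⊩ α) × (T ⊩ α → S ⊩ α)

    ≈-refl : ∀ {T} → T ≈ T
    ≈-refl _ _ = id , id

    -- Only groups without `a` are tested, so the condition is vacuous for a label within `⁅ a ⁆`: a
    -- child reachable by `a` alone needs no counterpart in `T`.
    Matched : Tr → Subset n × Tr → Set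
    Matched T (G′ , S′) = ∀ H → Nonempty H → a ∉ˢ H → H ⊆ˢ G′ →
      ∃[ c ] c ∈ succs T × H ⊆ˢ proj₁ c × S′ ≈ proj₂ c

    -- One step of a bisimulation argument. Going back, `a` may be dropped from a label, because a
    -- group without `a` inside the label survives the removal.
    ≈-node : ∀ {T v cs} → (∀ {q} → p ≢ q → v q ≡ val T q) →
      All (Matched T) cs →
      All (λ c → ∃[ c′ ] c′ ∈ cs × proj₁ c - a ⊆ˢ proj₁ c′ × proj₂ c′ ≈ proj₂ c) (succs T) →
      node v cs ≈ T
    ≈-node {T} {v} {cs} agree forth back = go
      where
      go : node v cs ≈ T
      go (var q) (f , _) = trans (sym (agree (f refl))) , trans (agree (f refl))
      go ⊥ᶠ _ = id , id
      go (α ∧ᶠ β) (f , g) = let x , y = go α (f ∘ inj₁ , g ∘ inj₁) ; z , w = go β (f ∘ inj₂ , g ∘ inj₂) in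
        (λ (s , t) → x s , z t) , (λ (s , t) → y s , w t)
      go (α ∨ᶠ β) (f , g) = let x , y = go α (f ∘ inj₁ , g ∘ inj₁) ; z , w = go β (f ∘ inj₂ , g ∘ inj₂) in
        Sum.map x z , Sum.map y w
      go (α →ᶠ β) (f , g) = let x , y = go α (f ∘ inj₁ , g ∘ inj₁) ; z , w = go β (f ∘ inj₂ , g ∘ inj₂) in
        (λ s → z ∘ s ∘ y) , (λ s → w ∘ s ∘ x)
      go (¬ᶠ α) o = let x , y = go α o in (λ s → s ∘ y) , (λ s → s ∘ x)
      go (D H α) (f , g) = to , from
        where
        a∉H : a ∉ˢ value H
        a∉H a∈ = g (inj₁ a∈) refl

        to : node v cs ⊩ D H α → T ⊩ D H α
        to s c∈ H⊆ = let c′ , c′∈ , ⊆c′ , eq = All.lookup back c∈ in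
          proj₁ (eq α (f , g ∘ inj₂)) (s c′∈ (⊆c′ ∘ ⊆-remove H⊆ a∉H))

        from : T ⊩ D H α → node v cs ⊩ D H α
        from s c′∈ H⊆ = let c , c∈ , H⊆c , eq = All.lookup forth c′∈ (value H) (nonempty H) a∉H H⊆ in
          proj₂ (eq α (f , g ∘ inj₂)) (s c∈ H⊆c)

    Refutable : Tr → List F → List F → Set
    Refutable T Γ Δ = ∃[ T′ ] Good L T′ × T′ ≈ T × Refutes T′ Γ Δ

    -- Interpolants and their composition along propositional rules.

    module _ (P : Pred Atom 0ℓ) (Q : Pred (Fin n) 0ℓ) where

      private
        Within Fresh : F → Set
        Within = Over P Q
        Fresh  = Over (P ∖ ｛ p ｝) (Q ∖ ｛ a ｝)

      -- A disjunct of an interpolant of Γ ⇒ Δ: its falsity at T supplies the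
      -- ingredient C T for the model refuting Γ ⇒ Δ.
      record Clause (Γ Δ : List F) (C : Tr → Set) : Set where
        field
          formula  : F
          fresh    : Fresh formula
          sound    : ∀ {T} → Good L T → T ⊩ formula → ¬ Refutes T Γ Δ
          complete : ∀ {T} → Good L T → ¬ (T ⊩ formula) → C T

      Interpolant : List F → List F → Set
      Interpolant Γ Δ = Clause Γ Δ (λ T → Refutable T Γ Δ)

      open Clause

      weaken : ∀ {Γ Δ C C′} → (∀ {T} → Good L T → C T → C′ T) → Clause Γ Δ C → Clause Γ Δ C′
      weaken f A = record
        { formula  = formula A
        ; fresh    = fresh A
        ; sound    = sound A
        ; complete = λ g ¬A → f g (complete A g ¬A)
        }

      falsum : ∀ {Γ Δ C} → (∀ {T} → Good L T → C T) → Clause Γ Δ C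
      falsum f = record
        { formula  = ⊥ᶠ
        ; fresh    = (λ ()) , (λ ())
        ; sound    = λ _ ()
        ; complete = λ g _ → f g
        }

      verum : ∀ {Γ Δ C} → L ⊢ Γ ⇒ Δ → Clause Γ Δ C
      verum d = record
        { formula  = ¬ᶠ ⊥ᶠ
        ; fresh    = (λ ()) , (λ ())
        ; sound    = λ g _ → soundness d g
        ; complete = λ _ ¬⊤ → ⊥-elim (¬⊤ id)
        }

      infixr 4 _or_

      _or_ : ∀ {Γ Δ C C′} → Clause Γ Δ C → Clause Γ Δ C′ → Clause Γ Δ (λ T → C T × C′ T)
      A or B = record
        { formula  = formula A ∨ᶠ formula B
        ; fresh    = [ proj₁ (fresh A) , proj₁ (fresh B) ]′ , [ proj₂ (fresh A) , proj₂ (fresh B) ]′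
        ; sound    = λ g → [ sound A g , sound B g ]′
        ; complete = λ g ¬AB → complete A g (¬AB ∘ inj₁) , complete B g (¬AB ∘ inj₂)
        }

      any-of : ∀ {I : Set} {Γ Δ is} {C : I → Tr → Set} → All (λ i → Clause Γ Δ (C i)) is →
               Clause Γ Δ (λ T → All (λ i → C i T) is)
      any-of []       = falsum λ _ → []
      any-of (A ∷ As) = weaken (λ _ (x , xs) → x ∷ xs) (A or any-of As)

      -- The interpolant is the conjunction over the premises: a false conjunct yields a tree
      -- refuting its premise, which `compose` turns into a refutation of the conclusion, while
      -- `decompose` gives soundness.
      reduce-interpolant : ∀ {l r Γ Δ} (ρ : Rule l r) →
        All (λ s → Interpolant (proj₁ s ++ Γ) (proj₂ s ++ Δ)) (Rule.premises ρ) → Interpolant (l ++ Γ) (r ++ Δ)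
      reduce-interpolant {l} {r} {Γ} {Δ} ρ Is = record
        { formula  = ⋀ Is
        ; fresh    = ⋀-fresh Is
        ; sound    = λ g t ref → let refₗᵣ , refΓΔ = refutes-++⁻ l r ref in
            ⋀-sound Is g t refΓΔ (Rule.decompose ρ refₗᵣ)
        ; complete = λ g → ⋀-complete Is (Rule.compose ρ) g
        }
        where
        Premise : List F × List F → Set
        Premise s = Interpolant (proj₁ s ++ Γ) (proj₂ s ++ Δ)

        ⋀ : ∀ {ss} → All Premise ss → F
        ⋀ []       = ¬ᶠ ⊥ᶠ
        ⋀ (I ∷ Is) = formula I ∧ᶠ ⋀ Is

        ⋀-fresh : ∀ {ss} (Is : All Premise ss) → Fresh (⋀ Is)
        ⋀-fresh []       = (λ ()) , (λ ())
        ⋀-fresh (I ∷ Is) = [ proj₁ (fresh I) , proj₁ (⋀-fresh Is) ]′ , [ proj₂ (fresh I) , proj₂ (⋀-fresh Is) ]′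

        ⋀-sound : ∀ {ss T} (Is : All Premise ss) → Good L T → T ⊩ ⋀ Is → Refutes T Γ Δ → ¬ Any (uncurry (Refutes T)) ss
        ⋀-sound (I ∷ Is) g (t , _) ref (here ref′)  = sound I g t (refutes-++⁺ ref′ ref)
        ⋀-sound (I ∷ Is) g (_ , t) ref (there ref′) = ⋀-sound Is g t ref ref′

        ⋀-complete : ∀ {ss T} (Is : All Premise ss) → All (λ s → ∀ T → uncurry (Refutes T) s → Refutes T l r) ss →
                     Good L T → ¬ (T ⊩ ⋀ Is) → Refutable T (l ++ Γ) (r ++ Δ)
        ⋀-complete [] [] g ¬⊤ = ⊥-elim (¬⊤ id)
        ⋀-complete {(X , Y) ∷ _} {T} (I ∷ Is) (f ∷ fs) g ¬t with T ⊩? formula I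
        ... | yes t  = ⋀-complete Is fs g (λ ts → ¬t (t , ts))
        ... | no ¬tI with complete I g ¬tI
        ...   | T′ , g′ , eq , ref with refutes-++⁻ X Y ref
        ...     | refXY , refΓΔ = T′ , g′ , eq , refutes-++⁺ (f T′ refXY) refΓΔ

      -- Disjuncts of the interpolant of a critical sequent.

      module _ {Γ Δ : List F} (cΓ : All Critical Γ) (cΔ : All Critical Δ) (oΓ : All Within Γ) (oΔ : All Within Δ)
        (rec : ∀ Γ′ Δ′ → weight Γ′ + weight Δ′ < weight Γ + weight Δ → All Within Γ′ → All Within Δ′ → Interpolant Γ′ Δ′) where

        -- The equation `var q ≡ γ` lets every member of `Γ` have a clause: boxes, `⊥ᶠ` and `p`
        -- itself contribute `falsum` and promise nothing.
        left-var : ∀ {γ} → γ ∈ Γ → Clause Γ Δ (λ T → ∀ {q} → var q ≡ γ → p ≢ q → val T q ≡ true)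
        left-var {γ} γ∈ with All.lookup cΓ γ∈
        ... | bot   = falsum λ _ ()
        ... | box _ = falsum λ _ ()
        ... | var {q} with p ≟ q
        ...   | yes refl = falsum λ { _ refl p≢p → contradiction refl p≢p }
        ...   | no p≢q   = record
          { formula  = ¬ᶠ var q
          ; fresh    = (λ { refl → proj₁ (All.lookup oΓ γ∈) refl , p≢q }) , λ ()
          ; sound    = λ _ ¬t ref → ¬t (All.lookup (proj₁ ref) γ∈)
          ; complete = λ { {T} _ ¬¬t refl _ → stable {T = T} (var q) ¬¬t }
          }

        right-var : ∀ {δ} → δ ∈ Δ → Clause Γ Δ (λ T → ∀ {q} → var q ≡ δ → p ≢ q → val T q ≢ true)
        right-var {δ} δ∈ with All.lookup cΔ δ∈
        ... | bot   = falsum λ _ ()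
        ... | box _ = falsum λ _ ()
        ... | var {q} with p ≟ q
        ...   | yes refl = falsum λ { _ refl p≢p → contradiction refl p≢p }
        ...   | no p≢q   = record
          { formula  = var q
          ; fresh    = (λ { refl → proj₁ (All.lookup oΔ δ∈) refl , p≢q }) , λ ()
          ; sound    = λ _ t ref → All.lookup (proj₂ ref) δ∈ t
          ; complete = λ { _ ¬t refl _ → ¬t }
          }

        -- Sound because a box for the smaller group `G - a` also governs the edges for `G`. If
        -- `G - a` is empty no such box exists, and the witness is later taken from the
        -- countermodel.
        right-box : ∀ {θ} → θ ∈ boxes Δ → Clause Γ Δ (λ T → Nonempty (value (proj₁ θ) - a) →
          ∃[ c ] c ∈ succs T × value (proj₁ θ) - a ⊆ˢ proj₁ c × Refutable (proj₂ c) (unbox (value (proj₁ θ)) Γ) (proj₂ θ ∷ []))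
        right-box {G , β} θ∈ with nonempty? (value G - a)
        ... | no empty = falsum λ _ ne → contradiction ne empty
        ... | yes ne = record
          { formula  = D (value G - a ⸴ [ ne ]) (formula I)
          ; fresh    = proj₁ (fresh I) , λ
              { (inj₁ b∈) → proj₂ oβ (inj₁ (p─q⊆p _ _ b∈)) , (λ { refl → ∉-remove (value G) a b∈ })
              ; (inj₂ b∈) → proj₂ (fresh I) b∈ }
          ; sound    = λ g t ref → All.lookup (proj₂ ref) (∈-boxes⁻ cΔ θ∈) λ c∈ G⊆ → stable β λ ¬β →
              sound I (good-succs g c∈) (t c∈ (G⊆ ∘ p─q⊆p _ _)) (unbox-forced (value G) cΓ (proj₁ ref) c∈ G⊆ , ¬β ∷ [])
          ; complete = λ {T} g ¬t _ → let c , c∈ , ⊆c , ¬I = ¬box⇒succ {T = T} {G = value G - a ⸴ [ ne ]} ¬t in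
              c , c∈ , ⊆c , complete I (good-succs g c∈) ¬I
          }
          where
          oβ : Within (D G β)
          oβ = All.lookup oΔ (∈-boxes⁻ cΔ θ∈)

          I : Interpolant (unbox (value G) Γ) (β ∷ [])
          I = rec _ _ (demand-smaller {G = value G} cΓ cΔ θ∈) (unbox-over (value G) cΓ oΓ) ((proj₁ oβ , proj₂ oβ ∘ inj₂) ∷ [])

        -- The formula is a diamond. When it is false, the interpolant of `unbox K Γ ⇒ []` fails at
        -- all `K`-successors at once, so each has an equivalent tree forcing `unbox K Γ`.
        union-clause : ∀ {K} → K ∈ unions (boxes Γ) → Clause Γ Δ (λ T → a ∉ˢ K → ∀ {c} → c ∈ succs T → K ⊆ˢ proj₁ c →
          Refutable (proj₂ c) (unbox K Γ) [])
        union-clause {K} K∈ with a ∈? K | null? (unbox K Γ)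
          where
          null? : ∀ (Γ : List F) → Dec (Γ ≡ [])
          null? []      = yes refl
          null? (_ ∷ _) = no λ ()
        ... | yes a∈ | _ = falsum λ _ a∉ → contradiction a∈ a∉
        -- With nothing to force, the successor itself serves. This covers the empty `K`, which is
        -- no group and cannot label a box.
        ... | no _ | yes eq = falsum λ g _ {c} c∈ _ → proj₂ c , good-succs g c∈ , ≈-refl ,
          subst (All (proj₂ c ⊩_)) (sym eq) [] , []
        ... | no a∉ | no ne = record
          { formula  = ¬ᶠ D Kᵍ (¬ᶠ formula I)
          ; fresh    = proj₁ (fresh I) , λ
              { (inj₁ b∈) → agents b∈ , (λ { refl → a∉ b∈ })
              ; (inj₂ b∈) → proj₂ (fresh I) b∈ }
          ; sound    = λ g t ref → t λ c∈ K⊆ tI →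
              sound I (good-succs g c∈) tI (unbox-forced K cΓ (proj₁ ref) c∈ K⊆ , [])
          ; complete = λ {T} g ¬¬t _ c∈ K⊆ → complete I (good-succs g c∈) (stable {T = T} (D Kᵍ (¬ᶠ formula I)) ¬¬t c∈ K⊆)
          }
          where
          Kᵍ : Grp n
          Kᵍ = K ⸴ [ unbox≢[]⇒nonempty {Γ = Γ} ne ]

          agents : ∀ {b} → b ∈ˢ K → Q b
          agents b∈ = let _ , θ∈ , b∈θ = unions⁻ (boxes Γ) K∈ b∈ in proj₂ (All.lookup oΓ (∈-boxes⁻ cΓ θ∈)) (inj₁ b∈θ)

          I : Interpolant (unbox K Γ) []
          I = rec _ _ (unbox-smaller {G = K} Δ cΓ ne) (unbox-over K cΓ oΓ) []

        -- Amalgamation of a refuting tree from `T` and a countermodel `M`.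

        module _ {T : Tr} (g : Good L T)
          (lv : All (λ γ → ∀ {q} → var q ≡ γ → p ≢ q → val T q ≡ true) Γ)
          (rv : All (λ δ → ∀ {q} → var q ≡ δ → p ≢ q → val T q ≢ true) Δ)
          (rb : All (λ θ → Nonempty (value (proj₁ θ) - a) → ∃[ c ] c ∈ succs T × value (proj₁ θ) - a ⊆ˢ proj₁ c ×
                           Refutable (proj₂ c) (unbox (value (proj₁ θ)) Γ) (proj₂ θ ∷ [])) (boxes Δ))
          (uc : All (λ K → a ∉ˢ K → ∀ {c} → c ∈ succs T → K ⊆ˢ proj₁ c → Refutable (proj₂ c) (unbox K Γ) []) (unions (boxes Γ)))
          {M : Tr} (gM : Good L M) (rM : Refutes M Γ Δ) where

          private
            Child : Set
            Child = Subset n × Tr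

            -- What the new root asks of each child: goodness, truth of the boxes of `Γ`, and one
            -- half of the agreement with `T`.
            Admissible : Child → Set
            Admissible c′ = Good L (proj₂ c′) × All (proj₂ c′ ⊩_) (unbox (proj₁ c′) Γ) × Matched T c′

            ⊆⁅a⁆-matched : ∀ {c′} → proj₁ c′ ⊆ˢ ⁅ a ⁆ → Matched T c′
            ⊆⁅a⁆-matched ⊆a _ (b , b∈) a∉ H⊆ with x∈⁅y⁆⇒x≡y a (⊆a (H⊆ b∈))
            ... | refl = contradiction b∈ a∉

            -- Agreement with `T` leaves the value at `p` free; it is chosen to suit `Γ`.
            valuation : Atom → Bool
            valuation q = if does (p ≟ q) then does (p var∈? Γ) else val T q

            valuation-≢ : ∀ {q} → p ≢ q → valuation q ≡ val T q
            valuation-≢ {q} p≢q with p ≟ q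
            ... | yes p≡q = contradiction p≡q p≢q
            ... | no _    = refl

            valuation-Γ : ∀ {q} → var q ∈ Γ → valuation q ≡ true
            valuation-Γ {q} ∈Γ with p ≟ q
            ... | yes refl = dec-true (p var∈? Γ) ∈Γ
            ... | no p≢q   = All.lookup lv ∈Γ refl p≢q

            valuation-Δ : ∀ {q} → var q ∈ Δ → valuation q ≢ true
            valuation-Δ {q} ∈Δ with p ≟ q
            -- The variable `p` cannot occur on both sides, since `M` refutes the sequent.
            ... | yes refl = λ eq → All.lookup (proj₂ rM) ∈Δ (All.lookup (proj₁ rM) (does⇒ (p var∈? Γ) eq))
            ... | no p≢q   = All.lookup rv ∈Δ refl p≢q

            -- Removing `a` from the label frees the copy from all boxes whose group contains `a`,
            -- about which the clauses of `T` say nothing.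
            copies : All (λ c → ∃[ c′ ] Admissible c′ × proj₁ c - a ⊆ˢ proj₁ c′ × proj₂ c′ ≈ proj₂ c) (succs T)
            copies = All.tabulate copy
              where
              copy : ∀ {c} → c ∈ succs T → ∃[ c′ ] Admissible c′ × proj₁ c - a ⊆ˢ proj₁ c′ × proj₂ c′ ≈ proj₂ c
              copy {G , S} c∈ with support (G - a) (boxes Γ)
              -- `K` lies within `G - a`, hence avoids `a`, and it unboxes the same formulas of `Γ`;
              -- so the clause for `K` provides the copy.
              ... | K , K∈ , K⊆ , max with All.lookup uc K∈ (∉-remove G a ∘ K⊆) c∈ (p─q⊆p _ _ ∘ K⊆)
              ...   | S′ , g′ , eq , fs , _ = (G - a , S′)
                , (g′ , All.tabulate (λ ∈u → let H , ∈b , H⊆ = ∈-unbox⁻ {Γ = Γ} ∈u in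
                                             All.lookup fs (∈-unbox⁺ {Γ = Γ} ∈b (max ∈b H⊆)))
                      , λ _ _ _ H⊆ → (G , S) , c∈ , (p─q⊆p _ _ ∘ H⊆) , eq)
                , id , eq

            -- A group with a member besides `a` gets its witness from the clause of its box.
            -- Otherwise the group is within `⁅ a ⁆`, where `Matched` is vacuous, and a successor in
            -- `M` can be taken unchanged.
            witnesses : All (λ θ → ∃[ c′ ] Admissible c′ × value (proj₁ θ) ⊆ˢ proj₁ c′ × ¬ (proj₂ c′ ⊩ proj₂ θ)) (boxes Δ)
            witnesses = All.tabulate witness
              where
              witness : ∀ {θ} → θ ∈ boxes Δ → ∃[ c′ ] Admissible c′ × value (proj₁ θ) ⊆ˢ proj₁ c′ × ¬ (proj₂ c′ ⊩ proj₂ θ)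
              witness {G , β} θ∈ with nonempty? (value G - a)
              ... | yes ne with All.lookup rb θ∈ ne
              ...   | c , c∈ , ⊆c , S′ , g′ , eq , fs , ¬β ∷ [] = (value G , S′)
                , (g′ , fs , λ _ _ a∉ H⊆ → c , c∈ , (⊆c ∘ ⊆-remove H⊆ a∉) , eq) , id , ¬β
              witness {G , β} θ∈ | no empty with ¬box⇒succ {T = M} {G = G} (All.lookup (proj₂ rM) (∈-boxes⁻ cΔ θ∈))
              ...   | c , c∈ , G⊆ , ¬β = (value G , proj₂ c)
                , (good-succs gM c∈ , unbox-forced (value G) cΓ (proj₁ rM) c∈ G⊆ , ⊆⁅a⁆-matched G⊆a) , id , ¬β
                where
                G⊆a : value G ⊆ˢ ⁅ a ⁆
                G⊆a {b} b∈ with b ≟ᶠ a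
                ... | yes refl = x∈⁅x⁆ a
                ... | no b≢a   = contradiction (b , x∈p∧x≢y⇒x∈p-y b∈ b≢a) empty

            -- The copies have lost `a` from their labels; in the serial logic an `a`-successor of
            -- `M` restores seriality for `a`.
            a-children : ∃[ cs ] All Admissible cs × (L ≡ KD-D → ∃[ c ] c ∈ cs × a ∈ˢ proj₁ c)
            a-children = by-logic L refl
              where
              by-logic : ∀ L′ → L ≡ L′ → ∃[ cs ] All Admissible cs × (L ≡ KD-D → ∃[ c ] c ∈ cs × a ∈ˢ proj₁ c)
              by-logic K-D  refl = [] , [] , λ ()
              by-logic KD-D refl with serial gM a
              ... | c , c∈ , a∈ = (⁅ a ⁆ , proj₂ c) ∷ []
                , (good-succs gM c∈ , unbox-forced ⁅ a ⁆ cΓ (proj₁ rM) c∈ a⊆ , ⊆⁅a⁆-matched id) ∷ []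
                , λ _ → _ , here refl , x∈⁅x⁆ a
                where
                a⊆ : ⁅ a ⁆ ⊆ˢ proj₁ c
                a⊆ b∈ = subst (_∈ˢ proj₁ c) (sym (x∈⁅y⁆⇒x≡y a b∈)) a∈

          -- The copies give the back condition of `≈-node`, admissibility of all children the forth
          -- condition, and the witnesses falsify the boxes of `Δ`.
          amalgamate : Refutable T Γ Δ
          amalgamate with choose copies | choose witnesses | a-children
          ... | cs₁ , back , adm₁ | cs₂ , wit , adm₂ | cs₃ , adm₃ , a-serial =
            node valuation cs , node good-serial (All.map proj₁ adm)
            , ≈-node valuation-≢ (All.map (λ (_ , _ , m) → m) adm)
                (All.map (λ (c′ , c′∈ , _ , sim) → c′ , ∈-++⁺ˡ c′∈ , sim) back)
            -- `M` forces all of `Γ`, so `⊥ᶠ` is not in `Γ`.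
            , refutes-node cΓ cΔ (All.lookup (proj₁ rM)) valuation-Γ valuation-Δ (All.map (λ (_ , fs , _) → fs) adm)
                (All.map (λ (c′ , c′∈ , _ , ref) → c′ , ∈-++⁺ʳ cs₁ (∈-++⁺ˡ c′∈) , ref) wit)
            where
            cs : List Child
            cs = cs₁ ++ cs₂ ++ cs₃

            adm : All Admissible cs
            adm = ++⁺ (All.map (λ (_ , _ , x , _) → x) adm₁) (++⁺ (All.map (λ (_ , _ , x , _) → x) adm₂) adm₃)

            good-serial : L ≡ KD-D → ∀ b → ∃[ c ] c ∈ cs × b ∈ˢ proj₁ c
            good-serial refl b with b ≟ᶠ a
            ... | yes refl = let c , c∈ , a∈ = a-serial refl in c , ∈-++⁺ʳ cs₁ (∈-++⁺ʳ cs₂ c∈) , a∈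
            -- Agents other than `a` keep their successors in the copies.
            ... | no b≢a   = let c , c∈ , b∈ = serial g b ; c′ , c′∈ , _ , ⊆c′ , _ = All.lookup back c∈ in
              c′ , ∈-++⁺ˡ c′∈ , ⊆c′ (x∈p∧x≢y⇒x∈p-y b∈ b≢a)

        -- Provability is decided first, since amalgamation draws on a countermodel `M`; the same
        -- `M` serves every `T`.
        critical-interpolant : Interpolant Γ Δ
        critical-interpolant with completeness L Γ Δ
        ... | inj₁ d = verum d
        ... | inj₂ (M , gM , rM) = weaken (λ g (lv , rv , rb , uc) → amalgamate g lv rv rb uc gM rM)
          (any-of (All.tabulate left-var) or any-of (All.tabulate right-var) or
           any-of (All.tabulate right-box) or any-of (All.tabulate union-clause))

      interpolate : ∀ Γ Δ → All Within Γ → All Within Δ → Interpolant Γ Δ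
      interpolate = search (λ Γ Δ → All Within Γ → All Within Δ → Interpolant Γ Δ) permute reduce
        (λ cΓ cΔ rec oΓ oΔ → critical-interpolant cΓ cΔ oΓ oΔ rec)
        where
        permute : ∀ {Γ Γ′ Δ Δ′ : List F} → Γ ↭ Γ′ → Δ ↭ Δ′ → (All Within Γ → All Within Δ → Interpolant Γ Δ) →
                  All Within Γ′ → All Within Δ′ → Interpolant Γ′ Δ′
        permute π ρ I oΓ oΔ = record
          { formula  = formula A
          ; fresh    = fresh A
          ; sound    = λ g t ref → sound A g t (refutes-↭ (↭-sym π) (↭-sym ρ) ref)
          ; complete = λ g ¬t → let T′ , g′ , eq , ref = complete A g ¬t in T′ , g′ , eq , refutes-↭ π ρ ref
          }
          where
          A : Interpolant _ _
          A = I (All-resp-↭ (↭-sym π) oΓ) (All-resp-↭ (↭-sym ρ) oΔ)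

        reduce : ∀ {l r Γ Δ : List F} (ρ : Rule l r) →
          All (λ s → All Within (proj₁ s ++ Γ) → All Within (proj₂ s ++ Δ) → Interpolant (proj₁ s ++ Γ) (proj₂ s ++ Δ))
            (Rule.premises ρ) →
          All Within (l ++ Γ) → All Within (r ++ Δ) → Interpolant (l ++ Γ) (r ++ Δ)
        reduce {l} {r} ρ Is oΓ oΔ = reduce-interpolant ρ (All.zipWith
          (λ (I , oX , oY) → I (++⁺ oX (++⁻ʳ l oΓ)) (++⁺ oY (++⁻ʳ r oΔ)))
          (Is , Rule.over ρ (++⁻ˡ l oΓ) (++⁻ˡ r oΔ)))

-- From semantic interpolants back to provability.

theorem5p5 : (n : ℕ) → .{{_ : NonZero n}} → (Atom : Set) → Atom ↣ ℕ →
    (L : Logic) (Γ Δ : List (Formula n Atom)) (p : Atom) (a : Fin n) →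
    ∃[ A ] ((V A ⊆ V* (Γ ++ Δ) ∖ ｛ p ｝) × (Agt A ⊆ Agt* (Γ ++ Δ) ∖ ｛ a ｝))
    × (L ⊢ Γ ++ (A ∷ []) ⇒ Δ)
    × ((Π Λ : List (Formula n Atom)) → p ∉ V* (Π ++ Λ) → a ∉ Agt* (Π ++ Λ) →
    L ⊢ Π ++ Γ ⇒ Δ ++ Λ → L ⊢ Π ⇒ A ∷ Λ)
theorem5p5 n Atom inj L Γ Δ p a = A , fresh , left , right
  where
  _≟_ : DecidableEquality Atom
  _≟_ = eq? inj

  within : All (Over (V* (Γ ++ Δ)) (Agt* (Γ ++ Δ))) (Γ ++ Δ)
  within = All.tabulate (λ ∈ΓΔ → lose ∈ΓΔ , lose ∈ΓΔ)

  open Clause (interpolate _≟_ L p a _ _ Γ Δ (++⁻ˡ Γ within) (++⁻ʳ Γ within)) renaming (formula to A)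

  left : L ⊢ Γ ++ (A ∷ []) ⇒ Δ
  left with completeness _≟_ L (Γ ++ (A ∷ [])) Δ
  ... | inj₁ d = d
  ... | inj₂ (T , g , γA , δ) with ++⁻ʳ Γ γA
  ...   | t ∷ [] = ⊥-elim (sound g t (++⁻ˡ Γ γA , δ))

  right : ∀ Π Λ → p ∉ V* (Π ++ Λ) → a ∉ Agt* (Π ++ Λ) → L ⊢ Π ++ Γ ⇒ Δ ++ Λ → L ⊢ Π ⇒ A ∷ Λ
  right Π Λ p∉ a∉ d with completeness _≟_ L Π (A ∷ Λ)
  ... | inj₁ d′ = d′
  ... | inj₂ (T , g , π , ¬t ∷ λs) with complete g ¬t
  -- `T′` refutes `Γ ⇒ Δ` and agrees with `T` on `Π` and `Λ`, which avoid `p` and `a`; so it refutes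
  -- the whole derivable sequent.
  ...   | T′ , g′ , eq , γ , δ = ⊥-elim (soundness d g′
    ( ++⁺ (All.tabulate (λ ∈Π → proj₂ (eq _ (avoids (∈-++⁺ˡ ∈Π))) (All.lookup π ∈Π))) γ
    , ++⁺ δ (All.tabulate (λ ∈Λ → All.lookup λs ∈Λ ∘ proj₁ (eq _ (avoids (∈-++⁺ʳ Π ∈Λ)))))))
    where
    avoids : ∀ {α} → α ∈ Π ++ Λ → Over (p ≢_) (a ≢_) α
    avoids ∈ΠΛ = (λ { q∈ refl → p∉ (lose ∈ΠΛ q∈) }) , (λ { b∈ refl → a∉ (lose ∈ΠΛ b∈) })
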